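{- Let $D$ be a finite tournament with vertex set $V$ and let $W_0\subseteq V$ be a set inducing an acyclic subdigraph of $D$. Then there are $W\supseteq W_0$ and $\mathcal C\in\mathrm{rs}(D)$ such that both $W$ and $V\setminus W$ induce acyclic subdigraphs of $D^{\mathcal C}$.
   Context: A tournament is a digraph (no loops) in which for all distinct $u,v$ exactly one of $uv$, $vu$ is an arc. A set of vertices is acyclic if the induced subdigraph contains no directed cycle. For a directed cycle $C$, $D^{C}$ is the digraph on $V(D)$ with arc set $(A(D)\setminus A(C))\cup\{vu: uv\in A(C)\}$. For finite $D$, $\mathrm{rs}(D)$ is the set of finite sequences $\langle C_0,\dots,C_{k-1}\rangle$ such that each $C_i$ is a directed cycle of $D^{\langle C_0,\dots,C_{i-1}\rangle}$, where $D^{\emptyset}=D$ and $D^{\mathcal C^\frown\langle C\rangle}=(D^{\mathcal C})^{C}$. -}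

module Defs where

open import Data.Nat using (ℕ; _≥_)
open import Data.Bool using (Bool; true; false; T; _∧_; _∨_; not)
open import Data.Fin using (Fin; _≟_)
open import Data.Fin.Subset using (Subset; _∈_)
open import Data.List using (List; []; _∷_; length; zip; _++_; [_])
open import Data.Bool.ListAction using (any)
open import Data.Unit using (⊤)
open import Data.List.Relation.Unary.All using (All)
open import Data.List.Relation.Unary.Unique.Propositional using (Unique)
open import Data.Product using (_×_; _,_)
open import Data.Sum using (_⊎_)
open import Data.Empty using (⊥)
open import Relation.Nullary using (¬_)
open import Relation.Nullary.Decidable using (⌊_⌋)
open import Relation.Binary.PropositionalEquality using (_≡_; _≢_)

Digraph : ℕ → Set
Digraph n = Fin n → Fin n → Bool

Arc : ∀ {n} → Digraph n → Fin n → Fin n → Set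
Arc D u v = T (D u v)

IsTournament : ∀ {n} → Digraph n → Set
IsTournament {n} D =
  (∀ (u : Fin n) → ¬ Arc D u u) ×
  (∀ (u v : Fin n) → u ≢ v → (Arc D u v ⊎ Arc D v u) × ¬ (Arc D u v × Arc D v u))

cycleArcs : ∀ {n} → List (Fin n) → List (Fin n × Fin n)
cycleArcs [] = []
cycleArcs (v ∷ vs) = zip (v ∷ vs) (vs ++ [ v ])

IsCycle : ∀ {n} → Digraph n → List (Fin n) → Set
IsCycle D C = Unique C × length C ≥ 2 × All (λ { (u , v) → Arc D u v }) (cycleArcs C)

arcIn : ∀ {n} → Fin n → Fin n → List (Fin n) → Bool
arcIn u v C = any (λ { (a , b) → ⌊ a ≟ u ⌋ ∧ ⌊ b ≟ v ⌋ }) (cycleArcs C)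

reverseCycle : ∀ {n} → Digraph n → List (Fin n) → Digraph n
reverseCycle D C u v = (D u v ∧ not (arcIn u v C)) ∨ arcIn v u C

applySeq : ∀ {n} → Digraph n → List (List (Fin n)) → Digraph n
applySeq D [] = D
applySeq D (C ∷ Cs) = applySeq (reverseCycle D C) Cs

InRS : ∀ {n} → Digraph n → List (List (Fin n)) → Set
InRS D [] = ⊤
InRS D (C ∷ Cs) = IsCycle D C × InRS (reverseCycle D C) Cs

Acyclic : ∀ {n} → Digraph n → Subset n → Set
Acyclic D W = ∀ C → IsCycle D C → All (_∈ W) C → ⊥

module Submission where

-- Keep W transitively ordered, let X be the rest, and induct on |X|.  A vertex dominating all
-- others in X can be put aside, and a vertex of X that fits into the order of W can be moved there.
-- If X has no dominating vertex, the pigeonhole principle gives b → c in X with equal outdegrees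
-- within X, hence also some z in X with c → z → b.  If c does not fit into W, then c → w → w′ → c
-- for some consecutive w, w′ in W.  If w′ → b, reversing c w w′ b transposes w and w′ and flips
-- b → c; otherwise b → w′, and reversing b w′ c z leaves W alone.  Either way one of b, c gains an
-- out-neighbour in X, the other loses one and no other outdegree within X changes, so the sum of
-- the squares of these outdegrees (the energy) grows.

open import Defs
open import Data.Nat using (ℕ)
open import Data.Fin.Subset using (Subset; _⊆_; ∁)
open import Data.List using (List)
open import Data.Fin using (Fin)
open import Data.Product using (Σ; _×_)

open import Data.Bool using (true; false; T; T?; not; if_then_else_; _∧_)
open import Data.Bool.Properties using (T-∧; T-∨)
import Data.Fin as Fin
import Data.Fin.Properties as Finₚ
import Data.Fin.Subset as Sub
import Data.Fin.Subset.Properties as Subₚ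
open import Data.List using ([]; _∷_; [_]; _++_; length; map; zip; lookup; filter; allFin)
import Data.List.Properties as Listₚ
open import Data.List.Membership.Propositional using (_∈_; _∉_)
open import Data.List.Membership.Propositional.Properties
  using (∈-∃++; ∈-allFin; ∈-filter⁺; ∈-filter⁻; ∈-lookup)
open import Data.List.Relation.Binary.Disjoint.Propositional using (Disjoint)
open import Data.List.Relation.Binary.Permutation.Propositional
  using (_↭_; refl; prep; swap; ↭-refl; ↭-sym; ↭-trans; ↭⇒↭ₛ)
import Data.List.Relation.Binary.Permutation.Propositional.Properties as Perm
import Data.List.Relation.Binary.Permutation.Setoid.Properties as PermSetoid
open import Data.List.Relation.Unary.All as All using (All; []; _∷_)
import Data.List.Relation.Unary.All.Properties as Allₚ
open import Data.List.Relation.Unary.AllPairs using (AllPairs; []; _∷_)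
open import Data.List.Relation.Unary.Any as Any using (Any; here; there)
import Data.List.Relation.Unary.Any.Properties as Anyₚ
open import Data.List.Relation.Unary.Unique.Propositional using (Unique)
import Data.List.Relation.Unary.Unique.Propositional.Properties as Uniqueₚ
open import Data.Nat using (zero; suc; _+_; _*_; _≤_; _<_; z≤n; s≤s; _≤?_)
open import Data.Nat.ListAction using (sum)
open import Data.Nat.ListAction.Properties using (sum-↭)
import Data.Nat.Properties as ℕ
open import Data.Nat.Solver using (module +-*-Solver)
open import Data.Product using (_,_; proj₁; proj₂; ∃-syntax; uncurry)
open import Data.Sum using (_⊎_; inj₁; inj₂; map₂)
open import Data.Vec using (tabulate)
import Data.Vec.Properties as Vecₚ
open import Function using (_∘_; id)
open import Function.Bundles using (Equivalence)
open import Relation.Binary.PropositionalEquality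
  using (_≡_; _≢_; refl; sym; trans; cong; cong₂; subst; setoid)
open import Relation.Nullary using (¬_; yes; no; contradiction)
open import Relation.Nullary.Decidable using (⌊_⌋; toWitness; fromWitness; ¬?)

open Equivalence using (to; from)

private
  variable
    n : ℕ
    D : Digraph n
    u v w x : Fin n
    C W X R : List (Fin n)

-- Tournaments

loopless : IsTournament D → Arc D u v → u ≢ v
loopless tour uv refl = proj₁ tour _ uv

asym : IsTournament D → Arc D u v → ¬ Arc D v u
asym {u = u} {v = v} tour uv vu = proj₂ (proj₂ tour u v (loopless tour uv)) (uv , vu)

total : IsTournament D → u ≢ v → ¬ Arc D u v → Arc D v u
total {u = u} {v = v} tour u≢v ¬uv with proj₁ (proj₂ tour u v u≢v)
... | inj₁ uv = contradiction uv ¬uv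
... | inj₂ vu = vu

-- Reversing a cycle

zip-∈⁻ : ∀ (xs ys : List (Fin n)) → (u , v) ∈ zip xs ys → u ∈ xs × v ∈ ys
zip-∈⁻ (x ∷ xs) (y ∷ ys) (here refl) = here refl , here refl
zip-∈⁻ (x ∷ xs) (y ∷ ys) (there p) with zip-∈⁻ xs ys p
... | u∈ , v∈ = there u∈ , there v∈

zip-∈⁺ʳ : ∀ (xs ys : List (Fin n)) → length xs ≡ length ys → v ∈ ys → ∃[ u ] (u , v) ∈ zip xs ys
zip-∈⁺ʳ (x ∷ xs) (y ∷ ys) eq (here refl) = x , here refl
zip-∈⁺ʳ (x ∷ xs) (y ∷ ys) eq (there p) with zip-∈⁺ʳ xs ys (ℕ.suc-injective eq) p
... | u , q = u , there q

cycleArcs-∈ : ∀ C → (u , v) ∈ cycleArcs {n} C → u ∈ C × v ∈ C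
cycleArcs-∈ (x ∷ xs) p with zip-∈⁻ (x ∷ xs) (xs ++ [ x ]) p
... | u∈ , v∈ = u∈ , Perm.∈-resp-↭ (↭-sym (Perm.∷↭∷ʳ x xs)) v∈

-- The heads of the cycle arcs are a rotation of the vertex list, so every vertex of the cycle
-- occurs as a head.
cycle-pred : IsCycle D C → v ∈ C → ∃[ u ] u ∈ C × Arc D u v
cycle-pred {C = x ∷ xs} (_ , _ , arcs) v∈
  with zip-∈⁺ʳ (x ∷ xs) (xs ++ [ x ]) (Perm.↭-length (Perm.∷↭∷ʳ x xs)) (Perm.∈-resp-↭ (Perm.∷↭∷ʳ x xs) v∈)
... | u , p = u , proj₁ (cycleArcs-∈ (x ∷ xs) p) , All.lookup arcs p

arcIn⁺ : ∀ C → (u , v) ∈ cycleArcs {n} C → T (arcIn u v C)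
arcIn⁺ {u = u} {v = v} C p = Anyₚ.any⁺ _ (Any.map (λ { refl → from (T-∧ {⌊ u Fin.≟ u ⌋})
  (fromWitness {a? = u Fin.≟ u} refl , fromWitness {a? = v Fin.≟ v} refl) }) p)

arcIn⁻ : ∀ C → T (arcIn {n} u v C) → (u , v) ∈ cycleArcs C
arcIn⁻ {u = u} {v = v} C p = Any.map agree (Anyₚ.any⁻ _ (cycleArcs C) p)
  where
  agree : ∀ {e} → T (⌊ proj₁ e Fin.≟ u ⌋ ∧ ⌊ proj₂ e Fin.≟ v ⌋) → (u , v) ≡ e
  agree {a , b} q with to (T-∧ {⌊ a Fin.≟ u ⌋}) q
  ... | a≡u , b≡v = sym (cong₂ _,_ (toWitness {a? = a Fin.≟ u} a≡u) (toWitness {a? = b Fin.≟ v} b≡v))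

reverse-flipped : ∀ C → (v , u) ∈ cycleArcs C → Arc (reverseCycle D C) u v
reverse-flipped C p = from T-∨ (inj₂ (arcIn⁺ C p))

T-not⁺ : ∀ {b} → ¬ T b → T (not b)
T-not⁺ {false} _  = _
T-not⁺ {true}  ¬t = ¬t _

T-not⁻ : ∀ {b} → T (not b) → ¬ T b
T-not⁻ {false} _ t = t

reverse-kept : ∀ C → Arc D u v → (u , v) ∉ cycleArcs C → Arc (reverseCycle D C) u v
reverse-kept C uv ∉ = from T-∨ (inj₁ (from T-∧ (uv , T-not⁺ (∉ ∘ arcIn⁻ C))))

reverse-arc⁻ : ∀ C → Arc (reverseCycle D C) u v →
  (Arc D u v × (u , v) ∉ cycleArcs C) ⊎ (v , u) ∈ cycleArcs C
reverse-arc⁻ C p with to T-∨ p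
... | inj₁ q = inj₁ (proj₁ (to T-∧ q) , T-not⁻ (proj₂ (to T-∧ q)) ∘ arcIn⁺ C)
... | inj₂ q = inj₂ (arcIn⁻ C q)

T-ext : ∀ {a b} → (T a → T b) → (T b → T a) → a ≡ b
T-ext {false} {false} _ _ = refl
T-ext {false} {true}  _ g = contradiction (g _) id
T-ext {true}  {false} f _ = contradiction (f _) id
T-ext {true}  {true}  _ _ = refl

reverse-≡ : ∀ C → (u , v) ∉ cycleArcs C → (v , u) ∉ cycleArcs C → reverseCycle D C u v ≡ D u v
reverse-≡ {D = D} C ∉₁ ∉₂ = T-ext fwd (λ uv → reverse-kept {D = D} C uv ∉₁)
  where
  fwd : Arc (reverseCycle D C) _ _ → Arc D _ _
  fwd p with reverse-arc⁻ {D = D} C p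
  ... | inj₁ (uv , _) = uv
  ... | inj₂ q        = contradiction q ∉₂

reverse-≡ˡ : ∀ C → u ∉ C → reverseCycle D C u v ≡ D u v
reverse-≡ˡ {D = D} C u∉ = reverse-≡ {D = D} C (u∉ ∘ proj₁ ∘ cycleArcs-∈ C) (u∉ ∘ proj₂ ∘ cycleArcs-∈ C)

reverse-≡ʳ : ∀ C → v ∉ C → reverseCycle D C u v ≡ D u v
reverse-≡ʳ {D = D} C v∉ = reverse-≡ {D = D} C (v∉ ∘ proj₂ ∘ cycleArcs-∈ C) (v∉ ∘ proj₁ ∘ cycleArcs-∈ C)

-- Whether a pair keeps its arc or has it flipped depends on whether that arc lies on the cycle. Two
-- opposite arcs after the reversal would trace back to two opposite arcs of `D` or to an arc both
-- on and off `C`.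
reverse-tournament : IsTournament D → IsCycle D C → IsTournament (reverseCycle D C)
reverse-tournament {D = D} {C = C} tour (_ , _ , arcs) = irr , λ u v u≢v → tot u v u≢v , uncurry anti
  where
  irr : ∀ u → ¬ Arc (reverseCycle D C) u u
  irr u p with reverse-arc⁻ {D = D} C p
  ... | inj₁ (uu , _) = proj₁ tour u uu
  ... | inj₂ q        = proj₁ tour u (All.lookup arcs q)

  half : ∀ {u v} → Arc D u v → Arc (reverseCycle D C) u v ⊎ Arc (reverseCycle D C) v u
  half {u} {v} uv with T? (arcIn u v C)
  ... | yes p = inj₂ (reverse-flipped {D = D} C (arcIn⁻ C p))
  ... | no ¬p = inj₁ (reverse-kept {D = D} C uv (¬p ∘ arcIn⁺ C))

  tot : ∀ u v → u ≢ v → Arc (reverseCycle D C) u v ⊎ Arc (reverseCycle D C) v u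
  tot u v u≢v with proj₁ (proj₂ tour u v u≢v)
  ... | inj₁ uv = half uv
  ... | inj₂ vu with half vu
  ...   | inj₁ p = inj₂ p
  ...   | inj₂ p = inj₁ p

  anti : ∀ {u v} → Arc (reverseCycle D C) u v → ¬ Arc (reverseCycle D C) v u
  anti p q with reverse-arc⁻ {D = D} C p | reverse-arc⁻ {D = D} C q
  ... | inj₁ (uv , _)  | inj₁ (vu , _)  = asym {D = D} tour uv vu
  ... | inj₁ (_ , uv∉) | inj₂ uv∈       = uv∉ uv∈
  ... | inj₂ vu∈       | inj₁ (_ , vu∉) = vu∉ vu∈
  ... | inj₂ vu∈       | inj₂ uv∈       = asym {D = D} tour (All.lookup arcs uv∈) (All.lookup arcs vu∈)

applySeq-tournament : ∀ 𝒞 → IsTournament D → InRS D 𝒞 → IsTournament (applySeq D 𝒞)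
applySeq-tournament []      tour _          = tour
applySeq-tournament {D = D} (C ∷ 𝒞) tour (cyc , rs) =
  applySeq-tournament 𝒞 (reverse-tournament {D = D} {C = C} tour cyc) rs

-- Transitive orders

-- Acyclic vertex sets are carried as lists in transitive order, so that insertions and exchanges
-- become operations on lists.
Chain : Digraph n → List (Fin n) → Set
Chain D = AllPairs (Arc D)

-- The first vertex of a chain has no in-neighbour in the chain, whereas every vertex of a cycle has
-- one on the cycle. The cycle therefore avoids it and lies in the tail.
chain-acyclic : IsTournament D → ∀ L → Chain D L → ∀ C → IsCycle D C → ¬ All (_∈ L) C
chain-acyclic tour []      _ []      (_ , () , _)
chain-acyclic tour []      _ (_ ∷ _) _ (() ∷ _)
chain-acyclic {D = D} tour (x ∷ L) (x→L ∷ chain) C cyc C⊆ =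
  chain-acyclic {D = D} tour L chain C cyc (All.tabulate C⊆L)
  where
  x∉C : x ∉ C
  x∉C x∈C with cycle-pred {D = D} {C = C} cyc x∈C
  ... | y , y∈C , yx with All.lookup C⊆ y∈C
  ...   | here refl = proj₁ tour _ yx
  ...   | there y∈L = asym {D = D} tour yx (All.lookup x→L y∈L)

  C⊆L : ∀ {v} → v ∈ C → v ∈ L
  C⊆L v∈C with All.lookup C⊆ v∈C
  ... | here refl = contradiction v∈C x∉C
  ... | there v∈L = v∈L

-- The obstruction to inserting `x`: if `L` is a chain, then `x`, `w`, `w′` form a directed
-- triangle.
Descent : Digraph n → Fin n → List (Fin n) → Set
Descent D x L = ∃[ P ] ∃[ w ] ∃[ w′ ] ∃[ Q ] L ≡ P ++ w ∷ w′ ∷ Q × Arc D x w × Arc D w′ x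

descent-∷ : ∀ y → Descent D x W → Descent D x (y ∷ W)
descent-∷ y (P , w , w′ , Q , refl , xw , w′x) = y ∷ P , w , w′ , Q , refl , xw , w′x

-- Walking on from the out-neighbour `y`, the first vertex that `x` does not dominate serves as
-- `w′`, and the one before it as `w`.
find-descent : IsTournament D → ∀ y L → x ∉ L → Arc D x y → ¬ All (Arc D x) L → Descent D x (y ∷ L)
find-descent tour y [] _ _ ¬all = contradiction [] ¬all
find-descent {D = D} {x = x} tour y (z ∷ L) x∉ xy ¬all with T? (D x z)
... | yes xz = descent-∷ {D = D} y (find-descent {D = D} tour z L (x∉ ∘ there) xz (¬all ∘ (xz ∷_)))
... | no ¬xz = [] , y , z , L , refl , xy , total {D = D} tour (x∉ ∘ here) ¬xz

-- The place for `x` is just before its first out-neighbour, or at the end if there is none. It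
-- fails only if some later vertex is not an out-neighbour, and then a descent exists.
insert : IsTournament D → ∀ L → Chain D L → x ∉ L → (∃[ L′ ] L′ ↭ x ∷ L × Chain D L′) ⊎ Descent D x L
insert tour [] _ _ = inj₁ (_ , ↭-refl , [] ∷ [])
insert {D = D} {x = x} tour (y ∷ L) (y→L ∷ chain) x∉ with T? (D x y) | All.all? (T? ∘ D x) L
... | yes xy | yes x→L = inj₁ (_ , ↭-refl , (xy ∷ x→L) ∷ y→L ∷ chain)
... | yes xy | no ¬x→L = inj₂ (find-descent {D = D} tour y L (x∉ ∘ there) xy ¬x→L)
... | no ¬xy | _ with insert {D = D} tour L chain (x∉ ∘ there)
...   | inj₂ desc = inj₂ (descent-∷ {D = D} y desc)
...   | inj₁ (L′ , L′↭ , chain′) =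
        inj₁ (y ∷ L′ , ↭-trans (prep y L′↭) (swap y x ↭-refl) ,
              Perm.All-resp-↭ (↭-sym L′↭) (total {D = D} tour (x∉ ∘ here) ¬xy ∷ y→L) ∷ chain′)

chain-adjacent : ∀ P {Q} → Chain D (P ++ w ∷ v ∷ Q) → Arc D w v
chain-adjacent []      ((wv ∷ _) ∷ _) = wv
chain-adjacent {D = D} (_ ∷ P) (_ ∷ chain) = chain-adjacent {D = D} P chain

chain-map : ∀ {D′ : Digraph n} L → (∀ {u v} → u ∈ L → v ∈ L → Arc D u v → Arc D′ u v) → Chain D L → Chain D′ L
chain-map []      f []              = []
chain-map {D = D} (x ∷ L) f (x→L ∷ chain) =
  All.tabulate (λ v∈ → f (here refl) (there v∈) (All.lookup x→L v∈)) ∷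
  chain-map {D = D} L (λ u∈ v∈ → f (there u∈) (there v∈)) chain

adjacent-↭ : ∀ (P : List (Fin n)) {w w′ Q} → P ++ w ∷ w′ ∷ Q ↭ P ++ w′ ∷ w ∷ Q
adjacent-↭ P = Perm.++⁺ˡ P (swap _ _ ↭-refl)

-- Only one adjacent pair changes its order, so every other arc must survive. For those arcs the
-- excluded case `u ≡ w × v ≡ w′` is impossible, because one of the two equalities would put a loop
-- into `D`.
chain-swap : ∀ {D′ : Digraph n} P {w w′ Q} → IsTournament D →
  (∀ {u v} → u ∈ P ++ w ∷ w′ ∷ Q → v ∈ P ++ w ∷ w′ ∷ Q → ¬ (u ≡ w × v ≡ w′) → Arc D u v → Arc D′ u v) →
  Arc D′ w′ w → Chain D (P ++ w ∷ w′ ∷ Q) → Chain D′ (P ++ w′ ∷ w ∷ Q)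
chain-swap {D = D} [] tour f w′w ((ww′ ∷ w→Q) ∷ w′→Q ∷ chain) =
  (w′w ∷ All.tabulate (λ v∈ →
    f (there (here refl)) (there (there v∈)) (λ { (refl , _) → proj₁ tour _ ww′ }) (All.lookup w′→Q v∈))) ∷
  All.tabulate (λ v∈ →
    f (here refl) (there (there v∈)) (λ { (_ , refl) → proj₁ tour _ (All.lookup w′→Q v∈) }) (All.lookup w→Q v∈)) ∷
  chain-map {D = D} _ (λ u∈ v∈ →
    f (there (there u∈)) (there (there v∈)) (λ { (_ , refl) → proj₁ tour _ (All.lookup w′→Q v∈) })) chain
chain-swap {D = D} (p ∷ P) {w} {w′} {Q} tour f w′w (p→ ∷ chain) =
  Perm.All-resp-↭ (adjacent-↭ P)
    (All.tabulate λ v∈ → f (here refl) (there v∈)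
      (λ { (refl , _) → proj₁ tour _ (All.lookup p→ (w∈ P)) }) (All.lookup p→ v∈)) ∷
  chain-swap {D = D} P tour (λ u∈ v∈ → f (there u∈) (there v∈)) w′w chain
  where
  w∈ : ∀ P → w ∈ P ++ w ∷ w′ ∷ Q
  w∈ P = Anyₚ.++⁺ʳ P (here refl)

-- Outdegrees

weight : Digraph n → Fin n → Fin n → ℕ
weight D u v = if D u v then 1 else 0

outdegree : Digraph n → List (Fin n) → Fin n → ℕ
outdegree D X v = sum (map (weight D v) X)

sq : ℕ → ℕ
sq s = s * s

-- The vertices summed over are separate from the list in which outdegrees are taken, so that a few
-- vertices can be split off while their arcs still count for the others.
squares : Digraph n → List (Fin n) → List (Fin n) → ℕ
squares D X R = sum (map (λ v → sq (outdegree D X v)) R)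

energy : Digraph n → List (Fin n) → ℕ
energy D X = squares D X X

weight-arc : Arc D u v → weight D u v ≡ 1
weight-arc {D = D} {u = u} {v = v} uv with D u v
... | true = refl

weight-¬arc : ¬ Arc D u v → weight D u v ≡ 0
weight-¬arc {D = D} {u = u} {v = v} ¬uv with D u v
... | true  = contradiction _ ¬uv
... | false = refl

weight-loop : IsTournament D → weight D v v ≡ 0
weight-loop {D = D} tour = weight-¬arc {D = D} (proj₁ tour _)

weight-back : IsTournament D → Arc D u v → weight D v u ≡ 0
weight-back {D = D} tour uv = weight-¬arc {D = D} (asym {D = D} tour uv)

weight≤1 : ∀ (D : Digraph n) u v → weight D u v ≤ 1
weight≤1 D u v with D u v
... | true  = ℕ.≤-refl
... | false = z≤n

sum-map-≤ : ∀ {A : Set} (f : A → ℕ) {k} → (∀ x → f x ≤ k) → ∀ xs → sum (map f xs) ≤ length xs * k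
sum-map-≤ f f≤k []       = z≤n
sum-map-≤ f f≤k (x ∷ xs) = ℕ.+-mono-≤ (f≤k x) (sum-map-≤ f f≤k xs)

outdegree≤length : ∀ (D : Digraph n) X v → outdegree D X v ≤ length X
outdegree≤length D X v =
  subst (outdegree D X v ≤_) (ℕ.*-identityʳ (length X)) (sum-map-≤ (weight D v) (weight≤1 D v) X)

energy≤ : ∀ (D : Digraph n) X → energy D X ≤ length X * (length X * length X)
energy≤ D X = sum-map-≤ _ (λ v → ℕ.*-mono-≤ (outdegree≤length D X v) (outdegree≤length D X v)) X

outdegree-↭ : X ↭ R → ∀ v → outdegree D X v ≡ outdegree D R v
outdegree-↭ {D = D} X↭ v = sum-↭ (Perm.map⁺ (weight D v) X↭)

energy-↭ : X ↭ R → energy D X ≡ energy D R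
energy-↭ {X = X} {D = D} X↭ = trans
  (cong sum (Listₚ.map-cong (λ v → cong sq (outdegree-↭ {D = D} X↭ v)) X))
  (sum-↭ (Perm.map⁺ _ X↭))

-- Each entry contributes at most one, so a single missing arc already keeps the sum below the
-- length.
outdegree-full : ∀ R → length R ≤ outdegree D R v → All (Arc D v) R
outdegree-full []      _ = []
outdegree-full {D = D} {v = v} (x ∷ R) len≤ with D v x in eq
... | true  = subst T (sym eq) _ ∷ outdegree-full {D = D} R (ℕ.≤-pred len≤)
... | false = contradiction (ℕ.≤-trans len≤ (outdegree≤length D R v)) (ℕ.<-irrefl refl)

outdegree-<⇒ : ∀ R → outdegree D R u < outdegree D R v → ∃[ z ] z ∈ R × Arc D v z × ¬ Arc D u z
outdegree-<⇒ {D = D} {u = u} {v = v} (x ∷ R) lt with D u x in equ | D v x in eqv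
... | false | true  = x , here refl , subst T (sym eqv) _ , subst T equ
... | false | false with outdegree-<⇒ {D = D} R lt
...   | z , z∈ , p = z , there z∈ , p
outdegree-<⇒ {D = D} (x ∷ R) lt | true | true with outdegree-<⇒ {D = D} R (ℕ.≤-pred lt)
...   | z , z∈ , p = z , there z∈ , p
-- Only `u` dominates the head here, so on `R` it trails `v` by even more.
outdegree-<⇒ {D = D} (x ∷ R) lt | true | false with outdegree-<⇒ {D = D} R (ℕ.<-trans (ℕ.n<1+n _) lt)
...   | z , z∈ , p = z , there z∈ , p

extract : x ∈ X → ∃[ R ] X ↭ x ∷ R
extract x∈ with ∈-∃++ x∈
... | P , Q , refl = P ++ Q , Perm.shift _ P Q

Unique-↭ : X ↭ R → Unique X → Unique R
Unique-↭ X↭ = PermSetoid.Unique-resp-↭ (setoid _) (↭⇒↭ₛ X↭)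

lookup-distinct : Unique X → ∀ {i j} → i Fin.< j → lookup X i ≢ lookup X j
lookup-distinct (x∉ ∷ _) {Fin.zero}  {Fin.suc j} _         = All.lookup x∉ (∈-lookup j)
lookup-distinct (_ ∷ uX) {Fin.suc i} {Fin.suc j} (s≤s i<j) = lookup-distinct uX i<j

Source : Digraph n → List (Fin n) → Set
Source D X = ∃[ x ] ∃[ R ] X ↭ x ∷ R × All (Arc D x) R

Tie : Digraph n → List (Fin n) → Set
Tie D X = ∃[ b ] ∃[ c ] ∃[ R ] X ↭ b ∷ c ∷ R × Arc D b c × outdegree D X b ≡ outdegree D X c

-- A vertex of outdegree at least `m` among `suc m` vertices dominates all the others, since it has
-- no arc to itself.
source-or-tie : ∀ {m} → IsTournament D → Unique X → length X ≡ suc m → Source D X ⊎ Tie D X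
source-or-tie {D = D} {X = X} {m = m} tour uX len
  with Finₚ.any? (λ i → m ≤? outdegree D X (lookup X i))
... | yes (i , m≤) with extract (∈-lookup {xs = X} i)
...   | R , X↭ = inj₁ (lookup X i , R , X↭ , outdegree-full {D = D} R (begin
          length R                    ≡⟨ ℕ.suc-injective (trans (sym (Perm.↭-length X↭)) len) ⟩
          m                           ≤⟨ m≤ ⟩
          outdegree D X a             ≡⟨ outdegree-↭ {D = D} X↭ a ⟩
          weight D a a + outdegree D R a
                                      ≡⟨ cong (_+ outdegree D R a) (weight-loop {D = D} {v = a} tour) ⟩
          outdegree D R a             ∎))
  where
  open ℕ.≤-Reasoning
  a = lookup X i
-- Now `suc m` outdegrees all lie below `m`, so two of them coincide.
source-or-tie {D = D} {X = X} {m = m} tour uX len | no ¬m≤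
  with Finₚ.pigeonhole (subst (m <_) (sym len) ℕ.≤-refl)
         (λ i → Fin.fromℕ< {outdegree D X (lookup X i)} (ℕ.≰⇒> (λ m≤ → ¬m≤ (i , m≤))))
... | i , j , i<j , eq =
  inj₂ (orient (∈-lookup i) (∈-lookup j) (lookup-distinct uX i<j) (Finₚ.fromℕ<-injective _ _ _ _ eq))
  where
  tie : ∀ {b c} → b ∈ X → c ∈ X → Arc D b c → outdegree D X b ≡ outdegree D X c → Tie D X
  tie b∈ c∈ bc same with extract b∈
  ... | R , X↭ with Perm.∈-resp-↭ X↭ c∈
  ...   | here refl  = contradiction bc (proj₁ tour _)
  ...   | there c∈R with extract c∈R
  ...     | S , R↭ = _ , _ , S , ↭-trans X↭ (prep _ R↭) , bc , same

  orient : ∀ {b c} → b ∈ X → c ∈ X → b ≢ c → outdegree D X b ≡ outdegree D X c → Tie D X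
  orient {b} {c} b∈ c∈ b≢c same with T? (D b c)
  ... | yes bc = tie b∈ c∈ bc same
  ... | no ¬bc = tie c∈ b∈ (total {D = D} tour b≢c ¬bc) (sym same)

-- Reversals that raise the energy

outdegree-cong : ∀ {D′ : Digraph n} R → (∀ {r} → r ∈ R → D′ v r ≡ D v r) → outdegree D′ R v ≡ outdegree D R v
outdegree-cong R f =
  cong sum (Listₚ.map-cong-local (All.tabulate (λ r∈ → cong (λ b → if b then 1 else 0) (f r∈))))

squares-cong : ∀ {D′ : Digraph n} R → (∀ {r} → r ∈ R → ∀ v → D′ r v ≡ D r v) → squares D′ X R ≡ squares D X R
squares-cong {D = D} {X = X} {D′ = D′} R f = cong sum (Listₚ.map-cong-local (All.tabulate λ r∈ →
  cong sq (outdegree-cong {D = D} {D′ = D′} X (λ {v} _ → f r∈ v))))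

-- Moving two equal values apart by one each raises the sum of their squares by two:
-- `(β + 2)² + β² = 2(β + 1)² + 2`.
spread-squares : ∀ β e → sq (suc β) + (sq (suc β) + e) < sq (suc (suc β)) + (sq β + e)
spread-squares β e = begin-strict
  sq (suc β) + (sq (suc β) + e)               <⟨ s≤s (ℕ.n≤1+n _) ⟩
  suc (suc (sq (suc β) + (sq (suc β) + e)))   ≡⟨ solve 2 (λ β e →
    con 2 :+ ((con 1 :+ β) :* (con 1 :+ β) :+ ((con 1 :+ β) :* (con 1 :+ β) :+ e))
    := (con 2 :+ β) :* (con 2 :+ β) :+ (β :* β :+ e)) refl β e ⟩
  sq (suc (suc β)) + (sq β + e)               ∎
  where
  open ℕ.≤-Reasoning
  open +-*-Solver

-- No arc at a vertex of `R` changes, so inside the list only the arc between `b` and `c` turns.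
-- From a common outdegree, `b` falls by one and `c` rises by one.
energy-transfer : ∀ {D′ : Digraph n} b c R → IsTournament D → IsTournament D′ →
  (∀ {r} → r ∈ R → ∀ v → D′ r v ≡ D r v) → (∀ {r} → r ∈ R → ∀ v → D′ v r ≡ D v r) →
  Arc D b c → Arc D′ c b → outdegree D (b ∷ c ∷ R) b ≡ outdegree D (b ∷ c ∷ R) c →
  energy D (b ∷ c ∷ R) < energy D′ (b ∷ c ∷ R)
energy-transfer {D = D} {D′ = D′} b c R tour tour′ out in′ bc cb same = begin-strict
  energy D Y                                ≡⟨ cong₂ (λ s t → sq s + (sq t + E)) sb (trans (sym same) sb) ⟩
  sq (suc β) + (sq (suc β) + E)             <⟨ spread-squares β E ⟩
  -- The larger square belongs to `c`, the second entry, so the two summands trade places.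
  sq (suc (suc β)) + (sq β + E)             ≡⟨ ℕ.+-assoc (sq (suc (suc β))) (sq β) E ⟨
  sq (suc (suc β)) + sq β + E               ≡⟨ cong (_+ E) (ℕ.+-comm (sq (suc (suc β))) (sq β)) ⟩
  sq β + sq (suc (suc β)) + E               ≡⟨ ℕ.+-assoc (sq β) (sq (suc (suc β))) E ⟩
  sq β + (sq (suc (suc β)) + E)             ≡⟨ cong₂ (λ s t → sq s + (sq t + E)) sb′ sc′ ⟨
  sq (outdegree D′ Y b) + (sq (outdegree D′ Y c) + E)
    ≡⟨ cong (λ e → sq (outdegree D′ Y b) + (sq (outdegree D′ Y c) + e))
            (squares-cong {D = D} {X = Y} {D′ = D′} R out) ⟨
  energy D′ Y                               ∎
  where
  open ℕ.≤-Reasoning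
  Y = b ∷ c ∷ R
  β = outdegree D R b
  E = squares D Y R

  expand : ∀ (D : Digraph _) v {i j l} → weight D v b ≡ i → weight D v c ≡ j →
    outdegree D R v ≡ l → outdegree D Y v ≡ i + (j + l)
  expand D v refl refl refl = refl

  rest : ∀ v → outdegree D′ R v ≡ outdegree D R v
  rest v = outdegree-cong {D = D} {D′ = D′} R (λ r∈ → in′ r∈ v)

  sb : outdegree D Y b ≡ suc β
  sb = expand D b (weight-loop {D = D} {v = b} tour) (weight-arc {D = D} bc) refl
  -- The arc from `b` to `c` counts for `b` alone, so the tie forces `c` to have one more
  -- out-neighbour in `R`.
  γ≡ : outdegree D R c ≡ suc β
  γ≡ = trans (sym (expand D c (weight-back {D = D} tour bc) (weight-loop {D = D} {v = c} tour) refl))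
             (trans (sym same) sb)
  sb′ : outdegree D′ Y b ≡ β
  sb′ = expand D′ b (weight-loop {D = D′} {v = b} tour′) (weight-back {D = D′} tour′ cb) (rest b)
  sc′ : outdegree D′ Y c ≡ suc (suc β)
  sc′ = expand D′ c (weight-arc {D = D′} cb) (weight-loop {D = D′} {v = c} tour′) (trans (rest c) γ≡)

-- Turning the arcs from `c` to `z` and from `z` to `b` takes an out-neighbour from `c` and gives
-- one to `b`, while `z` merely exchanges `b` for `c`.
energy-rotate : ∀ {D′ : Digraph n} b c z R → IsTournament D → IsTournament D′ →
  (∀ {r} → r ∈ R → ∀ v → D′ r v ≡ D r v) → (∀ {r} → r ∈ R → ∀ v → D′ v r ≡ D v r) →
  Arc D b c → Arc D c z → Arc D z b → Arc D′ b c → Arc D′ z c → Arc D′ b z →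
  outdegree D (b ∷ c ∷ z ∷ R) b ≡ outdegree D (b ∷ c ∷ z ∷ R) c →
  energy D (b ∷ c ∷ z ∷ R) < energy D′ (b ∷ c ∷ z ∷ R)
energy-rotate {D = D} {D′ = D′} b c z R tour tour′ out in′ bc cz zb bc′ zc′ bz′ same = begin-strict
  energy D Y                                ≡⟨ cong₂ (λ s t → sq s + (sq t + F)) sb (trans (sym same) sb) ⟩
  sq (suc β) + (sq (suc β) + F)             <⟨ spread-squares β F ⟩
  sq (suc (suc β)) + (sq β + F)             ≡⟨ cong₂ (λ s t → sq s + (sq t + F)) sb′ sc′ ⟨
  sq (outdegree D′ Y b) + (sq (outdegree D′ Y c) + F)
    ≡⟨ cong (λ e → sq (outdegree D′ Y b) + (sq (outdegree D′ Y c) + e))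
            (cong₂ (λ s e → sq s + e) (trans sz′ (sym sz)) (squares-cong {D = D} {X = Y} {D′ = D′} R out)) ⟨
  energy D′ Y                               ∎
  where
  open ℕ.≤-Reasoning
  Y = b ∷ c ∷ z ∷ R
  β = outdegree D R b
  ζ = outdegree D R z
  F = squares D Y (z ∷ R)

  expand : ∀ (D : Digraph _) v {i j k l} → weight D v b ≡ i → weight D v c ≡ j → weight D v z ≡ k →
    outdegree D R v ≡ l → outdegree D Y v ≡ i + (j + (k + l))
  expand D v refl refl refl refl = refl

  no-loop : ∀ v → weight D v v ≡ 0
  no-loop v = weight-loop {D = D} {v = v} tour
  no-loop′ : ∀ v → weight D′ v v ≡ 0
  no-loop′ v = weight-loop {D = D′} {v = v} tour′
  one : ∀ {u v} → Arc D u v → weight D u v ≡ 1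
  one = weight-arc {D = D}
  one′ : ∀ {u v} → Arc D′ u v → weight D′ u v ≡ 1
  one′ = weight-arc {D = D′}
  none : ∀ {u v} → Arc D u v → weight D v u ≡ 0
  none = weight-back {D = D} tour
  none′ : ∀ {u v} → Arc D′ u v → weight D′ v u ≡ 0
  none′ = weight-back {D = D′} tour′
  rest : ∀ v → outdegree D′ R v ≡ outdegree D R v
  rest v = outdegree-cong {D = D} {D′ = D′} R (λ r∈ → in′ r∈ v)

  sb : outdegree D Y b ≡ suc β
  sb = expand D b (no-loop b) (one bc) (none zb) refl
  -- In the triangle `b`, `c`, `z` each vertex has one out-neighbour, so the tie between `b` and `c`
  -- persists on `R`.
  γ≡ : outdegree D R c ≡ β
  γ≡ = ℕ.suc-injective (trans (sym (expand D c (none bc) (no-loop c) (one cz) refl)) (trans (sym same) sb))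
  sz : outdegree D Y z ≡ suc ζ
  sz = expand D z (one zb) (none cz) (no-loop z) refl
  sb′ : outdegree D′ Y b ≡ suc (suc β)
  sb′ = expand D′ b (no-loop′ b) (one′ bc′) (one′ bz′) (rest b)
  sc′ : outdegree D′ Y c ≡ β
  sc′ = expand D′ c (none′ bc′) (no-loop′ c) (none′ zc′) (trans (rest c) γ≡)
  sz′ : outdegree D′ Y z ≡ suc ζ
  sz′ = expand D′ z (none′ bz′) (one′ zc′) (no-loop′ z) (rest z)

-- One reversal step of the induction. The chain may be reordered but keeps its vertices, and
-- `within` ensures that arcs at vertices outside `W` and `X` are untouched.
record Improvement (D : Digraph n) (W X : List (Fin n)) : Set where
  field
    cycle    : List (Fin n)
    isCycle  : IsCycle D cycle
    within   : ∀ {v} → v ∈ cycle → v ∈ W ⊎ v ∈ X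
    chain    : List (Fin n)
    chain↭   : chain ↭ W
    isChain  : Chain (reverseCycle D cycle) chain
    energy<  : energy D X < energy (reverseCycle D cycle) X

dis⇒≢ : Disjoint W X → w ∈ W → x ∈ X → x ≢ w
dis⇒≢ dis w∈ x∈ refl = dis (w∈ , x∈)

-- The reversed cycle is `c w w′ b`. Its only arc inside the chain joins the neighbours `w` and
-- `w′`, so exchanging them restores the order; its only arc inside the rest is the one from `b` to
-- `c`.
transfer : ∀ P {w w′ Q b c R} → IsTournament D → Chain D (P ++ w ∷ w′ ∷ Q) →
  Unique (b ∷ c ∷ R) → Disjoint (P ++ w ∷ w′ ∷ Q) (b ∷ c ∷ R) →
  Arc D b c → outdegree D (b ∷ c ∷ R) b ≡ outdegree D (b ∷ c ∷ R) c →
  Arc D c w → Arc D w′ b → Improvement D (P ++ w ∷ w′ ∷ Q) (b ∷ c ∷ R)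
transfer {D = D} P {w} {w′} {Q} {b} {c} {R} tour chainW ((b≢c ∷ b∉R) ∷ c∉R ∷ uR) dis bc same cw w′b = record
  { cycle   = C₁
  ; isCycle = cyc
  ; within  = λ { (here refl) → inj₂ c∈ ; (there (here refl)) → inj₁ w∈
                ; (there (there (here refl))) → inj₁ w′∈ ; (there (there (there (here refl)))) → inj₂ b∈ }
  ; chain   = P ++ w′ ∷ w ∷ Q
  ; chain↭  = adjacent-↭ P
  ; isChain = chain-swap {D = D} P tour
      -- Of the four cycle arcs, all but the second have an end outside the chain.
      (λ u∈ v∈ ≢ww′ uv → reverse-kept {D = D} C₁ uv λ
        { (here refl) → dis (u∈ , c∈)
        ; (there (here refl)) → ≢ww′ (refl , refl)
        ; (there (there (here refl))) → dis (v∈ , b∈)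
        ; (there (there (there (here refl)))) → dis (u∈ , b∈) })
      (reverse-flipped {D = D} C₁ (there (here refl))) chainW
  ; energy< = energy-transfer {D = D} {D′ = reverseCycle D C₁} b c R tour
      (reverse-tournament {D = D} {C = C₁} tour cyc)
      (λ r∈ v → reverse-≡ˡ {D = D} C₁ (outside r∈)) (λ r∈ v → reverse-≡ʳ {D = D} C₁ (outside r∈))
      bc (reverse-flipped {D = D} C₁ (there (there (there (here refl))))) same
  }
  where
  w∈ : w ∈ P ++ w ∷ w′ ∷ Q
  w∈ = Anyₚ.++⁺ʳ P (here refl)
  w′∈ : w′ ∈ P ++ w ∷ w′ ∷ Q
  w′∈ = Anyₚ.++⁺ʳ P (there (here refl))
  C₁ = c ∷ w ∷ w′ ∷ b ∷ []
  b∈ : b ∈ b ∷ c ∷ R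
  b∈ = here refl
  c∈ : c ∈ b ∷ c ∷ R
  c∈ = there (here refl)
  arc = chain-adjacent {D = D} P chainW
  cyc : IsCycle D C₁
  cyc = ((dis⇒≢ dis w∈ c∈ ∷ dis⇒≢ dis w′∈ c∈ ∷ (b≢c ∘ sym) ∷ []) ∷
         (loopless {D = D} tour arc ∷ (dis⇒≢ dis w∈ b∈ ∘ sym) ∷ []) ∷
         ((dis⇒≢ dis w′∈ b∈ ∘ sym) ∷ []) ∷ [] ∷ []) ,
        s≤s (s≤s z≤n) , cw ∷ arc ∷ w′b ∷ bc ∷ []
  outside : ∀ {r} → r ∈ R → r ∉ C₁
  outside r∈ (here refl)                         = All.lookup c∉R r∈ refl
  outside r∈ (there (here refl))                 = dis (w∈ , there (there r∈))
  outside r∈ (there (there (here refl)))         = dis (w′∈ , there (there r∈))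
  outside r∈ (there (there (there (here refl)))) = All.lookup b∉R r∈ refl

-- The reversed cycle `b w′ c z` meets the chain in `w′` alone, so no arc inside the chain turns.
-- Inside the rest exactly the arcs from `c` to `z` and from `z` to `b` turn.
rotate : ∀ P {w w′ Q b c z R} → IsTournament D → Chain D (P ++ w ∷ w′ ∷ Q) →
  Unique (b ∷ c ∷ z ∷ R) → Disjoint (P ++ w ∷ w′ ∷ Q) (b ∷ c ∷ z ∷ R) →
  Arc D b c → Arc D c z → Arc D z b → outdegree D (b ∷ c ∷ z ∷ R) b ≡ outdegree D (b ∷ c ∷ z ∷ R) c →
  Arc D b w′ → Arc D w′ c → Improvement D (P ++ w ∷ w′ ∷ Q) (b ∷ c ∷ z ∷ R)
rotate {D = D} P {w} {w′} {Q} {b} {c} {z} {R} tour chainW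
  ((b≢c ∷ b≢z ∷ b∉R) ∷ (c≢z ∷ c∉R) ∷ z∉R ∷ uR) dis bc cz zb same bw wc = record
  { cycle   = C₂
  ; isCycle = cyc
  ; within  = λ { (here refl) → inj₂ b∈ ; (there (here refl)) → inj₁ w′∈
                ; (there (there (here refl))) → inj₂ c∈ ; (there (there (there (here refl)))) → inj₂ z∈ }
  ; chain   = P ++ w ∷ w′ ∷ Q
  ; chain↭  = ↭-refl
  ; isChain = chain-map {D = D} (P ++ w ∷ w′ ∷ Q)
      (λ u∈ v∈ uv → reverse-kept {D = D} C₂ uv λ
        { (here refl) → dis (u∈ , b∈)
        ; (there (here refl)) → dis (v∈ , c∈)
        ; (there (there (here refl))) → dis (u∈ , c∈)
        ; (there (there (there (here refl)))) → dis (u∈ , z∈) })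
      chainW
  ; energy< = energy-rotate {D = D} {D′ = reverseCycle D C₂} b c z R tour
      (reverse-tournament {D = D} {C = C₂} tour cyc)
      (λ r∈ v → reverse-≡ˡ {D = D} C₂ (outside r∈)) (λ r∈ v → reverse-≡ʳ {D = D} C₂ (outside r∈))
      bc cz zb
      -- Both ends lie on the cycle, but this arc is a chord of it.
      (reverse-kept {D = D} C₂ bc λ
        { (here refl) → dis (w′∈ , c∈)
        ; (there (here refl)) → dis (w′∈ , b∈)
        ; (there (there (here refl))) → b≢c refl
        ; (there (there (there (here refl)))) → b≢z refl })
      (reverse-flipped {D = D} C₂ (there (there (here refl))))
      (reverse-flipped {D = D} C₂ (there (there (there (here refl))))) same
  }
  where
  w′∈ : w′ ∈ P ++ w ∷ w′ ∷ Q
  w′∈ = Anyₚ.++⁺ʳ P (there (here refl))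
  C₂ = b ∷ w′ ∷ c ∷ z ∷ []
  b∈ : b ∈ b ∷ c ∷ z ∷ R
  b∈ = here refl
  c∈ : c ∈ b ∷ c ∷ z ∷ R
  c∈ = there (here refl)
  z∈ : z ∈ b ∷ c ∷ z ∷ R
  z∈ = there (there (here refl))
  cyc : IsCycle D C₂
  cyc = ((dis⇒≢ dis w′∈ b∈ ∷ b≢c ∷ b≢z ∷ []) ∷
         ((dis⇒≢ dis w′∈ c∈ ∘ sym) ∷ (dis⇒≢ dis w′∈ z∈ ∘ sym) ∷ []) ∷
         (c≢z ∷ []) ∷ [] ∷ []) ,
        s≤s (s≤s z≤n) , bw ∷ wc ∷ cz ∷ zb ∷ []
  outside : ∀ {r} → r ∈ R → r ∉ C₂
  outside r∈ (here refl)                         = All.lookup b∉R r∈ refl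
  outside r∈ (there (here refl))                 = dis (w′∈ , there (there (there r∈)))
  outside r∈ (there (there (here refl)))         = All.lookup c∉R r∈ refl
  outside r∈ (there (there (there (here refl)))) = All.lookup z∉R r∈ refl

-- Since `b` spends one of its equally many out-neighbours on `c`, it has fewer than `c` in `R`.
-- Hence `c` dominates some `z` in `R` that `b` does not.
tie-triangle : ∀ {b c} R → IsTournament D → Unique (b ∷ c ∷ R) → Arc D b c →
  outdegree D (b ∷ c ∷ R) b ≡ outdegree D (b ∷ c ∷ R) c → ∃[ z ] z ∈ R × Arc D c z × Arc D z b
tie-triangle {D = D} {b = b} {c = c} R tour ((_ ∷ b∉R) ∷ _) bc same with outdegree-<⇒ {D = D} R lt
  where
  lt : outdegree D R b < outdegree D R c
  lt = ℕ.≤-reflexive (trans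
    (sym (cong₂ (λ p q → p + (q + outdegree D R b)) (weight-loop {D = D} {v = b} tour) (weight-arc {D = D} bc)))
    (trans same
    (cong₂ (λ p q → p + (q + outdegree D R c)) (weight-back {D = D} tour bc) (weight-loop {D = D} {v = c} tour))))
... | z , z∈ , cz , ¬bz = z , z∈ , cz , total {D = D} tour (All.lookup b∉R z∈) ¬bz

-- Splitting a tournament into two chains

-- The field `local` lets a vertex be set aside during the recursion: its arcs are the same when it
-- is put back.
record Splitting (D : Digraph n) (W X : List (Fin n)) : Set where
  field
    reversals  : List (List (Fin n))
    valid      : InRS D reversals
    upper      : List (Fin n)
    lower      : List (Fin n)
    upperChain : Chain (applySeq D reversals) upper
    lowerChain : Chain (applySeq D reversals) lower
    W⊆upper    : ∀ {v} → v ∈ W → v ∈ upper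
    lower⊆X    : ∀ {v} → v ∈ lower → v ∈ X
    X⊆         : ∀ {v} → v ∈ X → v ∈ upper ⊎ v ∈ lower
    local      : ∀ {u} → u ∉ W → u ∉ X → ∀ v → applySeq D reversals u v ≡ D u v

open Splitting

splitting-[] : Chain D W → Splitting D W []
splitting-[] {W = W} chain = record
  { reversals = [] ; valid = _ ; upper = W ; lower = [] ; upperChain = chain ; lowerChain = []
  ; W⊆upper = id ; lower⊆X = id ; X⊆ = inj₂ ; local = λ _ _ _ → refl }

splitting-↭ : X ↭ R → Splitting D W X → Splitting D W R
splitting-↭ X↭ s = record
  { Splitting s
  ; lower⊆X = Perm.∈-resp-↭ X↭ ∘ lower⊆X s
  ; X⊆      = X⊆ s ∘ Perm.∈-resp-↭ (↭-sym X↭)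
  ; local   = λ u∉W u∉R → local s u∉W (u∉R ∘ Perm.∈-resp-↭ X↭)
  }

-- The reversals found for `R` leave the arcs at `x` alone, so `x` still dominates whatever part of
-- `R` ends up in `lower` and can head that chain.
splitting-source : x ∉ W → x ∉ R → All (Arc D x) R → Splitting D W R → Splitting D W (x ∷ R)
splitting-source {x = x} {R = R} x∉W x∉R x→R s = record
  { Splitting s
  ; lower      = x ∷ lower s
  ; lowerChain = All.tabulate (λ v∈ → subst T (sym (local s x∉W x∉R _)) (All.lookup x→R (lower⊆X s v∈))) ∷ lowerChain s
  ; lower⊆X    = λ { (here refl) → here refl ; (there v∈) → there (lower⊆X s v∈) }
  ; X⊆         = λ { (here refl) → inj₂ (here refl) ; (there v∈) → map₂ there (X⊆ s v∈) }
  ; local      = λ u∉W u∉ → local s u∉W (u∉ ∘ there)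
  }

splitting-insert : ∀ {W′} → W′ ↭ x ∷ W → Splitting D W′ R → Splitting D W (x ∷ R)
splitting-insert {x = x} {W = W} {W′ = W′} W′↭ s = record
  { Splitting s
  ; W⊆upper = W⊆upper s ∘ ⊆W′ ∘ there
  ; lower⊆X = there ∘ lower⊆X s
  ; X⊆      = λ { (here refl) → inj₁ (W⊆upper s (⊆W′ (here refl))) ; (there v∈) → X⊆ s v∈ }
  ; local   = λ u∉W u∉ → local s (λ u∈ → case (Perm.∈-resp-↭ W′↭ u∈) u∉W (u∉ ∘ here)) (u∉ ∘ there)
  }
  where
  ⊆W′ : ∀ {v} → v ∈ x ∷ W → v ∈ W′
  ⊆W′ = Perm.∈-resp-↭ (↭-sym W′↭)
  case : ∀ {u} → u ∈ x ∷ W → u ∉ W → u ≢ x → T false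
  case (here eq)   _   u≢x = u≢x eq
  case (there u∈W) u∉W _   = u∉W u∈W

splitting-reverse : (i : Improvement D W X) →
  Splitting (reverseCycle D (Improvement.cycle i)) (Improvement.chain i) X → Splitting D W X
splitting-reverse {D = D} {W = W} {X = X} i s = record
  { Splitting s
  ; reversals = I.cycle ∷ reversals s
  ; valid     = I.isCycle , valid s
  ; W⊆upper   = W⊆upper s ∘ Perm.∈-resp-↭ (↭-sym I.chain↭)
  ; local     = λ {u} u∉W u∉X v → trans (local s (u∉W ∘ Perm.∈-resp-↭ I.chain↭) u∉X v)
                  (reverse-≡ˡ {D = D} I.cycle (λ u∈ → case (I.within u∈) u∉W u∉X))
  }
  where
  module I = Improvement i
  case : ∀ {u} → u ∈ W ⊎ u ∈ X → u ∉ W → u ∉ X → T false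
  case (inj₁ p) u∉W _ = u∉W p
  case (inj₂ p) _ u∉X = u∉X p

-- The vertex `c` is tried for insertion; a descent `w`, `w′` supplies the cycle to reverse. The
-- rest is returned up to permutation because the second kind of cycle needs its third vertex `z` in
-- front.
insert-or-improve : ∀ {b c R} → IsTournament D → Chain D W → Unique (b ∷ c ∷ R) → Disjoint W (b ∷ c ∷ R) →
  Arc D b c → outdegree D (b ∷ c ∷ R) b ≡ outdegree D (b ∷ c ∷ R) c →
  (∃[ W′ ] W′ ↭ c ∷ W × Chain D W′) ⊎ (∃[ X ] X ↭ b ∷ c ∷ R × Improvement D W X)
insert-or-improve {D = D} {W = W} {b = b} {c = c} {R = R} tour chain uX dis bc same
  with insert {D = D} tour W chain (λ c∈ → dis (c∈ , there (here refl)))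
... | inj₁ inserted = inj₁ inserted
... | inj₂ (P , w , w′ , Q , refl , cw , w′c) with T? (D w′ b)
...   | yes w′b = inj₂ (_ , ↭-refl , transfer {D = D} P tour chain uX dis bc same cw w′b)
-- Now `b` dominates `w′`, so a path leads from `b` through `w′` to `c`, and `z` closes it to a
-- cycle.
...   | no ¬w′b with tie-triangle {D = D} R tour uX bc same
...     | z , z∈ , cz , zb with extract z∈
...       | S , R↭ = inj₂ (_ , ↭-sym X↭ , rotate {D = D} P tour chain (Unique-↭ X↭ uX)
              (λ (v∈W , v∈) → dis (v∈W , Perm.∈-resp-↭ (↭-sym X↭) v∈)) bc cz zb
              (trans (sym (outdegree-↭ {D = D} X↭ b)) (trans same (outdegree-↭ {D = D} X↭ c)))
              (total {D = D} tour (λ { refl → dis (Anyₚ.++⁺ʳ P (there (here refl)) , here refl) }) ¬w′b) w′c)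
  where
  X↭ : b ∷ c ∷ R ↭ b ∷ c ∷ z ∷ S
  X↭ = prep b (prep c R↭)

-- The induction hypothesis ranges over all tournaments and chains, as both change along the way.
Splittable : ℕ → ℕ → Set
Splittable n m = ∀ (D : Digraph n) W X → IsTournament D → Chain D W → Unique X → Disjoint W X →
  length X ≡ m → Splitting D W X

-- The energy never exceeds the cube of |X|, so the fuel k counts the rises still possible before X must shrink.
raise-energy : ∀ {m} → Splittable n m → ∀ k (D : Digraph n) W X →
  IsTournament D → Chain D W → Unique X → Disjoint W X →
  length X ≡ suc m → suc m * (suc m * suc m) ≤ energy D X + k → Splitting D W X
raise-energy {m = m} smaller k D W X tour chain uX dis len fuel with source-or-tie {D = D} tour uX len
... | inj₁ (x , R , X↭ , x→R) with Unique-↭ X↭ uX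
...   | x∉R ∷ uR = splitting-↭ {D = D} (↭-sym X↭)
          (splitting-source {D = D} (λ x∈W → dis (x∈W , Perm.∈-resp-↭ (↭-sym X↭) (here refl)))
            (λ x∈R → All.lookup x∉R x∈R refl) x→R
            (smaller D W R tour chain uR
              (λ (v∈W , v∈R) → dis (v∈W , Perm.∈-resp-↭ (↭-sym X↭) (there v∈R)))
              (ℕ.suc-injective (trans (sym (Perm.↭-length X↭)) len))))
raise-energy {m = m} smaller k D W X tour chain uX dis len fuel | inj₂ (b , c , R , X↭ , bc , same)
  with insert-or-improve {D = D} tour chain (Unique-↭ X↭ uX)
         (λ (v∈W , v∈) → dis (v∈W , Perm.∈-resp-↭ (↭-sym X↭) v∈)) bc
         (trans (sym (outdegree-↭ {D = D} X↭ b)) (trans same (outdegree-↭ {D = D} X↭ c)))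
... | inj₁ (W′ , W′↭ , chain′) with Unique-↭ (↭-trans X↭ (swap b c ↭-refl)) uX
...   | c∉ ∷ uR = splitting-↭ {D = D} (↭-sym X↭′) (splitting-insert {D = D} W′↭
          (smaller D W′ (b ∷ R) tour chain′ uR dis′
            (ℕ.suc-injective (trans (sym (Perm.↭-length X↭′)) len))))
  where
  X↭′ : X ↭ c ∷ b ∷ R
  X↭′ = ↭-trans X↭ (swap b c ↭-refl)
  dis′ : Disjoint W′ (b ∷ R)
  dis′ (v∈W′ , v∈) with Perm.∈-resp-↭ W′↭ v∈W′
  ... | here refl = All.lookup c∉ v∈ refl
  ... | there v∈W = dis (v∈W , Perm.∈-resp-↭ (↭-sym X↭′) (there v∈))
raise-energy {m = m} smaller k D W X tour chain uX dis len fuel | inj₂ (b , c , R , X↭ , bc , same) | inj₂ (Y , Y↭ , i) =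
  splitting-↭ {D = D} (↭-sym X↭Y) (splitting-reverse {D = D} i (continue k fuel))
  where
  module I = Improvement i
  X↭Y : X ↭ Y
  X↭Y = ↭-trans X↭ (↭-sym Y↭)
  D′ = reverseCycle D I.cycle
  M = suc m * (suc m * suc m)
  rises : energy D X < energy D′ Y
  rises = subst (_< energy D′ Y) (sym (energy-↭ {D = D} X↭Y)) I.energy<
  lenY : length Y ≡ suc m
  lenY = trans (sym (Perm.↭-length X↭Y)) len
  continue : ∀ k → M ≤ energy D X + k → Splitting D′ I.chain Y
  -- With the fuel exhausted the energy is already at least the cubic bound, and a further rise
  -- would exceed it.
  continue zero    fuel = contradiction
    (ℕ.≤-<-trans (subst (M ≤_) (ℕ.+-identityʳ _) fuel)
      (ℕ.<-≤-trans rises (subst (λ l → energy D′ Y ≤ l * (l * l)) lenY (energy≤ D′ Y))))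
    (ℕ.<-irrefl refl)
  -- The strict rise in energy pays for the unit of fuel spent.
  continue (suc k) fuel = raise-energy smaller k D′ I.chain Y
    (reverse-tournament {D = D} {C = I.cycle} tour I.isCycle) I.isChain (Unique-↭ X↭Y uX)
    (λ (v∈W , v∈) → dis (Perm.∈-resp-↭ I.chain↭ v∈W , Perm.∈-resp-↭ (↭-sym X↭Y) v∈)) lenY
    (ℕ.≤-trans fuel (subst (_≤ energy D′ Y + k) (sym (ℕ.+-suc _ k)) (ℕ.+-monoˡ-≤ k rises)))

split : ∀ m → Splittable n m
split zero    D W [] tour chain uX dis len = splitting-[] {D = D} chain
split (suc m) D W X tour chain uX dis len =
  -- Fuel equal to the whole bound suffices for any initial energy.
  raise-energy (split m) (suc m * (suc m * suc m)) D W X tour chain uX dis len (ℕ.m≤n+m _ _)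

-- From acyclic sets to chains and back

descent-cycle : IsTournament D → ∀ L → Chain D L → Descent D x L →
  ∃[ C ] IsCycle D C × (∀ {v} → v ∈ C → v ∈ x ∷ L)
descent-cycle {D = D} {x = x} tour L chain (P , w , w′ , Q , refl , xw , w′x) =
  x ∷ w ∷ w′ ∷ [] ,
  (((loopless {D = D} tour xw ∷ (loopless {D = D} tour w′x ∘ sym) ∷ []) ∷
    (loopless {D = D} tour ww′ ∷ []) ∷ [] ∷ []) ,
   s≤s (s≤s z≤n) , xw ∷ ww′ ∷ w′x ∷ []) ,
  λ { (here refl) → here refl
    ; (there (here refl)) → there (Anyₚ.++⁺ʳ P (here refl))
    ; (there (there (here refl))) → there (Anyₚ.++⁺ʳ P (there (here refl))) }
  where
  ww′ = chain-adjacent {D = D} P chain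

-- Insertion sort: a failed insertion would yield a descent and with it a directed triangle inside
-- `W₀`.
acyclic-chain : IsTournament D → ∀ {W₀} → Acyclic D W₀ → ∀ L → Unique L → All (Sub._∈ W₀) L →
  ∃[ L′ ] L′ ↭ L × Chain D L′
acyclic-chain tour acyc []      _          _             = [] , ↭-refl , []
acyclic-chain {D = D} tour acyc (x ∷ L) (x∉L ∷ uL) (x∈ ∷ L⊆) with acyclic-chain {D = D} tour acyc L uL L⊆
... | L′ , L′↭ , chain with insert {D = D} tour L′ chain (λ x∈L′ → All.lookup x∉L (Perm.∈-resp-↭ L′↭ x∈L′) refl)
...   | inj₁ (L″ , L″↭ , chain″) = L″ , ↭-trans L″↭ (prep x L′↭) , chain″
...   | inj₂ desc with descent-cycle {D = D} tour L′ chain desc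
...     | C , cyc , C⊆ = contradiction cyc λ cyc → acyc C cyc
            (All.tabulate λ v∈ → All.lookup (x∈ ∷ L⊆) (Perm.∈-resp-↭ (prep x L′↭) (C⊆ v∈)))

fromList : List (Fin n) → Subset n
fromList L = tabulate (λ v → ⌊ Any.any? (v Fin.≟_) L ⌋)

∈-fromList⁺ : v ∈ W → v Sub.∈ fromList W
∈-fromList⁺ {v = v} v∈ = Vecₚ.lookup⇒[]= v _ (trans (Vecₚ.lookup∘tabulate _ v) (T-ext _ (λ _ → fromWitness v∈)))

∈-fromList⁻ : v Sub.∈ fromList W → v ∈ W
∈-fromList⁻ {v = v} v∈ = toWitness (subst T (trans (sym (Vecₚ.[]=⇒lookup v∈)) (Vecₚ.lookup∘tabulate _ v)) _)

theorem7p1 : (n : ℕ) (D : Digraph n) → IsTournament D →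
    (W₀ : Subset n) → Acyclic D W₀ →
    Σ (Subset n) (λ W → Σ (List (List (Fin n))) (λ 𝒞 →
    W₀ ⊆ W × InRS D 𝒞 × Acyclic (applySeq D 𝒞) W × Acyclic (applySeq D 𝒞) (∁ W)))
theorem7p1 n D tour W₀ acyc
  with acyclic-chain {D = D} tour acyc (filter (Subₚ._∈? W₀) (allFin n))
         (Uniqueₚ.filter⁺ (Subₚ._∈? W₀) (Uniqueₚ.allFin⁺ n)) (Allₚ.all-filter (Subₚ._∈? W₀) (allFin n))
... | L , L↭ , chain =
  fromList (upper s) , reversals s ,
  (λ v∈ → ∈-fromList⁺ (W⊆upper s (L⊇ v∈))) ,
  valid s ,
  (λ C cyc C⊆ → chain-acyclic {D = D′} tour′ (upper s) (upperChain s) C cyc (All.map ∈-fromList⁻ C⊆)) ,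
  (λ C cyc C⊆ → chain-acyclic {D = D′} tour′ (lower s) (lowerChain s) C cyc (All.map ∁⊆lower C⊆))
  where
  X₀ = filter (¬? ∘ (Subₚ._∈? W₀)) (allFin n)
  L⊆ : ∀ {v} → v ∈ L → v Sub.∈ W₀
  L⊆ v∈ = proj₂ (∈-filter⁻ (Subₚ._∈? W₀) {xs = allFin n} (Perm.∈-resp-↭ L↭ v∈))
  L⊇ : ∀ {v} → v Sub.∈ W₀ → v ∈ L
  L⊇ v∈ = Perm.∈-resp-↭ (↭-sym L↭) (∈-filter⁺ (Subₚ._∈? W₀) (∈-allFin _) v∈)
  s : Splitting D L X₀
  s = split (length X₀) D L X₀ tour chain (Uniqueₚ.filter⁺ (¬? ∘ (Subₚ._∈? W₀)) (Uniqueₚ.allFin⁺ n))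
        (λ (v∈L , v∈X) → proj₂ (∈-filter⁻ (¬? ∘ (Subₚ._∈? W₀)) {xs = allFin n} v∈X) (L⊆ v∈L))
        refl
  D′ = applySeq D (reversals s)
  tour′ : IsTournament D′
  tour′ = applySeq-tournament {D = D} (reversals s) tour (valid s)
  -- Every vertex starts in `L` or `X₀` and so ends in one of the two chains; the complement of the
  -- upper one therefore lies in the lower one.
  covered : ∀ v → v ∈ upper s ⊎ v ∈ lower s
  covered v with v Subₚ.∈? W₀
  ... | yes v∈ = inj₁ (W⊆upper s (L⊇ v∈))
  ... | no v∉  = X⊆ s (∈-filter⁺ (¬? ∘ (Subₚ._∈? W₀)) (∈-allFin v) v∉)
  ∁⊆lower : ∀ {v} → v Sub.∈ ∁ (fromList (upper s)) → v ∈ lower s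
  ∁⊆lower {v} v∈ with covered v
  ... | inj₁ v∈upper = contradiction (∈-fromList⁺ v∈upper) (Subₚ.x∈∁p⇒x∉p v∈)
  ... | inj₂ v∈lower = v∈lower
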